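{- Let $G$ be a matching covered graph and let $K$ be any 3-claw of $G$. Then $K$ is a subgraph of some conformal subgraph $H$ of $G$ such that $H$ is either a bi-subdivision of $\Theta$ or a bi-subdivision of $K_4$.
   Context: Graphs are finite and loopless; multiple edges are allowed. A graph is matchable if it has a perfect matching (the empty graph is matchable). A connected graph with at least two vertices is matching covered if each edge lies in some perfect matching. $\Theta$ is the graph with two vertices joined by three edges. A 3-claw of a graph $G$ is a subgraph formed by three distinct edges that are all incident with a common vertex (two or all three of these edges may be parallel). A subgraph $H$ of $G$ is conformal if $G-V(H)$ is matchable. A bi-subdivision of a graph $J$ is a graph obtained from $J$ by subdividing each edge of some subset of $E(J)$ with an even number of subdivision vertices. -}

module Defs where

open import Data.Bool.Base using (Bool; T; not; _∧_)
open import Data.Bool.Properties using (T-∧)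
open import Data.Fin.Base as Fin using (Fin; zero; suc; toℕ; inject₁)
open import Data.Fin.Properties using (toℕ-inject₁; <⇒≢)
open import Data.Fin.Relation.Unary.Top using (View; view; ‵fromℕ; ‵inject₁)
open import Data.Nat.Base using (ℕ; zero; suc)
open import Data.Nat.Divisibility using (_∣_)
open import Data.Nat.Properties using (1+n≢n)
open import Data.Product using (∃; ∃-syntax; Σ-syntax; ∃!; _×_; _,_; proj₁; proj₂)
open import Data.Sum.Base using (_⊎_; inj₁; inj₂)
open import Data.Sum.Properties using (inj₁-injective)
open import Function.Base using (_∘_)
open import Function.Bundles using (_↔_; _⇔_; Inverse; Equivalence)
open import Relation.Binary.Construct.Closure.ReflexiveTransitive using (Star)
open import Relation.Binary.PropositionalEquality
  using (_≡_; _≢_; refl; sym; trans; cong)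

-- Loopless multigraphs. Each edge is stored with an arbitrary orientation;
-- no notion below depends on it. Finiteness is the separate predicate `Finite`,
-- so that subgraphs and subdivisions can be given their natural carriers
-- (all of which are finite when those of the original graph are).

record Graph : Set₁ where
  field
    V E      : Set
    src tgt  : E → V
    loopless : ∀ e → src e ≢ tgt e

open Graph public

infix 4 _IsBisubdivisionOf_

Finite : Graph → Set
Finite G = (∃[ n ] (V G ↔ Fin n)) × (∃[ m ] (E G ↔ Fin m))

module _ (G : Graph) where

  Incident : E G → V G → Set
  Incident e v = src G e ≡ v ⊎ tgt G e ≡ v

  Joins : E G → V G → V G → Set
  Joins e u v = (src G e ≡ u × tgt G e ≡ v) ⊎ (src G e ≡ v × tgt G e ≡ u)

  Adjacent : V G → V G → Set
  Adjacent u v = ∃[ e ] Joins e u v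

  -- On the empty vertex set this holds vacuously; matching covered graphs are
  -- separately required to have two vertices.
  Connected : Set
  Connected = ∀ u v → Star Adjacent u v

  PerfectMatching : (E G → Bool) → Set
  PerfectMatching M = ∀ v → ∃! _≡_ λ e → T (M e) × Incident e v

  Matchable : Set
  Matchable = ∃[ M ] PerfectMatching M

  record MatchingCovered : Set where
    field
      connected   : Connected
      twoVertices : Σ[ u ∈ V G ] Σ[ v ∈ V G ] u ≢ v
      covered     : ∀ e → ∃[ M ] (PerfectMatching M × T (M e))

record Iso (G H : Graph) : Set where
  field
    onV   : V G ↔ V H
    onE   : E G ↔ E H
    joins : ∀ e → Joins H (Inverse.to onE e)
                    (Inverse.to onV (src G e)) (Inverse.to onV (tgt G e))

record Subgraph (G : Graph) : Set where
  field
    VS     : V G → Bool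
    ES     : E G → Bool
    closed : ∀ e → T (ES e) → T (VS (src G e)) × T (VS (tgt G e))

open Subgraph public

module _ {G : Graph} where

  infix 4 _⊑_

  _⊑_ : Subgraph G → Subgraph G → Set
  K ⊑ H = (∀ v → T (VS K v) → T (VS H v)) × (∀ e → T (ES K e) → T (ES H e))

  graph : Subgraph G → Graph
  graph H .V = Σ[ v ∈ V G ] T (VS H v)
  graph H .E = Σ[ e ∈ E G ] T (ES H e)
  graph H .src (e , p) = src G e , proj₁ (closed H e p)
  graph H .tgt (e , p) = tgt G e , proj₂ (closed H e p)
  graph H .loopless (e , _) = loopless G e ∘ cong proj₁

  ThreeClaw : Subgraph G → Set
  ThreeClaw K =
    ∃[ c ] ∃[ e₁ ] ∃[ e₂ ] ∃[ e₃ ]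
      (e₁ ≢ e₂ × e₁ ≢ e₃ × e₂ ≢ e₃)
      × (Incident G e₁ c × Incident G e₂ c × Incident G e₃ c)
      × (∀ e → T (ES K e) ⇔ (e ≡ e₁ ⊎ e ≡ e₂ ⊎ e ≡ e₃))
      × (∀ v → T (VS K v) ⇔ (∃[ e ] (T (ES K e) × Incident G e v)))

deleteVertices : (G : Graph) → (V G → Bool) → Subgraph G
deleteVertices G X .VS v = not (X v)
deleteVertices G X .ES e = not (X (src G e)) ∧ not (X (tgt G e))
deleteVertices G X .closed e = Equivalence.to T-∧

Conformal : {G : Graph} → Subgraph G → Set
Conformal {G} H = Matchable (graph (deleteVertices G (VS H)))

-- subdivide J s replaces each edge e of J by a path from src e to tgt e with
-- s e internal vertices (e , 0), …, (e , s e - 1), in this order along the path.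
-- Its edges are (e , 0), …, (e , s e), where (e , i) enters internal vertex i,
-- except that the last one enters tgt e.

module _ (J : Graph) (s : E J → ℕ) where

  SubV : Set
  SubV = V J ⊎ (Σ[ e ∈ E J ] Fin (s e))

  pathSrc : ∀ e → Fin (suc (s e)) → SubV
  pathSrc e zero    = inj₁ (src J e)
  pathSrc e (suc i) = inj₂ (e , i)

  pathTgt : ∀ e {i : Fin (suc (s e))} → View i → SubV
  pathTgt e ‵fromℕ       = inj₁ (tgt J e)
  pathTgt e (‵inject₁ i) = inj₂ (e , i)

  private
    index : SubV → ℕ
    index (inj₁ _)       = 0
    index (inj₂ (_ , i)) = toℕ i

    src≢tgt : ∀ e {i} (w : View i) → pathSrc e i ≢ pathTgt e w
    src≢tgt e w = go _ w refl
      where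
      go : ∀ i {k} (w : View k) → i ≡ k → pathSrc e i ≢ pathTgt e w
      go zero    ‵fromℕ       _  eq = loopless J e (inj₁-injective eq)
      go zero    (‵inject₁ _) _  ()
      go (suc _) ‵fromℕ       _  ()
      go (suc i) (‵inject₁ j) i≡ eq =
        1+n≢n (trans (cong toℕ i≡) (trans (toℕ-inject₁ j) (sym (cong index eq))))

  subdivide : Graph
  subdivide .V = SubV
  subdivide .E = Σ[ e ∈ E J ] Fin (suc (s e))
  subdivide .src (e , i) = pathSrc e i
  subdivide .tgt (e , i) = pathTgt e (view i)
  subdivide .loopless (e , i) = src≢tgt e (view i)

-- The subset of subdivided edges is the set of e with s e ≢ 0.
_IsBisubdivisionOf_ : Graph → Graph → Set
H IsBisubdivisionOf J = ∃[ s ] ((∀ e → 2 ∣ s e) × Iso H (subdivide J s))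

Θ : Graph
Θ .V = Fin 2
Θ .E = Fin 3
Θ .src _ = zero
Θ .tgt _ = suc zero
Θ .loopless _ ()

Complete : ℕ → Graph
Complete n .V = Fin n
Complete n .E = Σ[ (i , j) ∈ Fin n × Fin n ] i Fin.< j
Complete n .src ((i , _) , _) = i
Complete n .tgt ((_ , j) , _) = j
Complete n .loopless (_ , i<j) = <⇒≢ i<j

{-# OPTIONS --safe #-}
module Submission where

-- Let M₁, M₂, M₃ be perfect matchings containing the claw edges cb, cu, cv.
-- Alternating between M₁ and M₂ (M₃) gives an even M₁-alternating walk P (Q)
-- from b to u (v) that avoids c. It suffices to find inside P ∪ Q a conformal
-- "spider": either three even legs from a centre to b, v, u, or an odd cycle cut
-- into three odd sides with an even leg to b, v, u at each corner; adding c
-- then gives a bi-subdivision of Θ or of K₄. The spider is built by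
-- induction on P, looking at how Q meets P.

open import Defs
import Algebra.Solver.CommutativeMonoid as CMSolver
open import Data.Bool.Base using (Bool; T)
open import Data.Bool.Properties using (T-irrelevant; T-∧)
open import Data.Empty using (⊥; ⊥-elim)
open import Data.Fin.Base using (Fin; zero; suc; toℕ; fromℕ)
open import Data.Fin.Patterns using (0F; 1F; 2F; 3F)
open import Data.Fin.Properties using (toℕ-inject₁; <-irrelevant; <-asym; inj⇒≟)
open import Data.Fin.Relation.Unary.Top using (View; view; ‵fromℕ; ‵inject₁)
open import Data.List.Base using (List; []; _∷_; _++_; [_]; length; map; concatMap; lookup; tabulate; allFin)
open import Data.List.Properties
  using (++-assoc; length-++; map-++; map-∘; map-concatMap; concatMap-cong; map-tabulate; tabulate-lookup)
open import Data.List.Membership.Propositional using (_∈_; _∉_; lose)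
open import Data.List.Membership.Propositional.Properties
  using (∈-++⁺ˡ; ∈-++⁺ʳ; ∈-++⁻; ∈-∃++; ∈-insert; ∈-map⁺; ∈-map⁻; ∈-concatMap⁺; ∈-tabulate⁺; ∈-allFin)
import Data.List.Membership.DecPropositional as DecMembership
open import Data.List.Relation.Binary.Disjoint.Propositional using (Disjoint)
open import Data.List.Relation.Binary.Permutation.Propositional
  using (_↭_; ↭-refl; ↭-sym; ↭-trans; ↭-prep; ↭-reflexive; ↭⇒↭ₛ; module PermutationReasoning)
open import Data.List.Relation.Binary.Permutation.Propositional.Properties
  using (∈-resp-↭; ++⁺ˡ; ++⁺ʳ; ++-comm; shift; ++-commutativeMonoid; ↭-length)
import Data.List.Relation.Binary.Permutation.Setoid.Properties as PermutationSetoid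
open import Data.List.Relation.Binary.Subset.Propositional using (_⊆_)
open import Data.List.Relation.Unary.All as All using (All; []; _∷_)
open import Data.List.Relation.Unary.All.Properties using (All¬⇒¬Any) renaming (++⁻ to All-++⁻)
open import Data.List.Relation.Unary.AllPairs using ([]; _∷_)
open import Data.List.Relation.Unary.Any using (here; there)
open import Data.List.Relation.Unary.Unique.Propositional using (Unique)
import Data.List.Relation.Unary.Unique.Propositional.Properties as UniqueProps
open import Data.Nat.Base using (ℕ; suc; _<_; s≤s; z≤n)
open import Data.Nat.Divisibility using (_∣_; _∣0; ∣-refl; ∣m∣n⇒∣m+n)
open import Data.Nat.Induction using (Acc; acc; <-wellFounded)
open import Data.Nat.Properties using (≤-trans; ≤-reflexive; n≤1+n; m≤n+m; m<m+n)
open import Data.Product using (∃-syntax; Σ-syntax; _×_; _,_; proj₁; proj₂)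
open import Data.Sum.Base as Sum using (_⊎_; inj₁; inj₂; [_,_]′)
open import Data.Sum.Properties using (inj₁-injective; inj₂-injective)
open import Function.Base using (_∘_)
open import Function.Bundles using (_↔_; Inverse; Equivalence; mk↔ₛ′)
open import Function.Properties.Inverse using (↔⇒↣)
open import Relation.Binary.Definitions using (DecidableEquality)
open import Relation.Binary.PropositionalEquality
  using (_≡_; _≢_; refl; sym; trans; cong; cong₂; subst; setoid)
open import Relation.Nullary using (yes; no)
open import Relation.Nullary.Decidable
  using (⌊_⌋; toWitness; toWitnessFalse; fromWitness; fromWitnessFalse)

-- The induction passes to subwalks of P and Q with other ends, so it is stated for arbitrary
-- M₁-alternating walks with a common start; M₂ and M₃ no longer occur in it. The available vertices
-- always form a union of M₁-edges, so whatever two disjoint walks leave over is matched by M₁ at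
-- once. Trees and triangles have to be produced together: closing off a smaller tree gives a
-- triangle, and closing off a smaller triangle gives a tree. The second change deletes odd walks,
-- whose interiors are rematched along the walks themselves, possibly outside M₁; hence a spider
-- carries its own matching of the rest. A spider lists its vertices and the rest up to permutation,
-- so that simplicity and disjointness of its walks follow from the absence of repetitions in one
-- list.

-- Lists without repetitions and their complements

module _ {A : Set} where

  Unique-resp-↭ : {xs ys : List A} → xs ↭ ys → Unique xs → Unique ys
  Unique-resp-↭ p = PermutationSetoid.Unique-resp-↭ (setoid A) (↭⇒↭ₛ p)

  Unique-++⁻ : ∀ (xs : List A) {ys} → Unique (xs ++ ys) → Unique xs × Unique ys × Disjoint xs ys
  Unique-++⁻ [] u = [] , u , λ ()
  Unique-++⁻ (x ∷ xs) (x∉ ∷ u) with Unique-++⁻ xs u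
  ... | ux , uy , dis = proj₁ (All-++⁻ xs x∉) ∷ ux , uy , λ where
    (here refl , q) → All¬⇒¬Any x∉ (∈-++⁺ʳ xs q)
    (there p , q)   → dis (p , q)

  Unique⇒complement : ∀ (xs : List A) {ys} → Unique xs → xs ⊆ ys → ∃[ zs ] ys ↭ xs ++ zs
  Unique⇒complement [] _ _ = _ , ↭-refl
  Unique⇒complement (x ∷ xs) (x∉ ∷ u) sub with ∈-∃++ (sub (here refl))
  ... | as , bs , refl with Unique⇒complement xs {as ++ bs} u (λ {y} p → remove p (∈-resp-↭ (shift x as bs) (sub (there p))))
    where
    remove : ∀ {y zs} → y ∈ xs → y ∈ x ∷ zs → y ∈ zs
    remove p (here refl) = ⊥-elim (All¬⇒¬Any x∉ p)
    remove p (there q)   = q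
  ... | zs , perm = zs , ↭-trans (shift x as bs) (↭-prep x perm)

  Closed : (A → A) → List A → Set
  Closed f xs = ∀ {x} → x ∈ xs → f x ∈ xs

  complement-∈ : ∀ {xs ys zs : List A} {x} → zs ↭ xs ++ ys → x ∈ zs → x ∉ xs → x ∈ ys
  complement-∈ {xs} p x∈ x∉ with ∈-++⁻ xs (∈-resp-↭ p x∈)
  ... | inj₁ q = ⊥-elim (x∉ q)
  ... | inj₂ q = q

  -- An involution that carried a point of the rest into `xs` would carry it back out, although it
  -- preserves `xs`.
  complement-closed : ∀ {f : A → A} (inv : ∀ x → f (f x) ≡ x) {xs ys zs} → zs ↭ xs ++ ys →
                      Unique zs → Closed f zs → Closed f xs → Closed f ys
  complement-closed inv {xs} p uz cz cx {x} x∈ =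
    complement-∈ p (cz (∈-resp-↭ (↭-sym p) (∈-++⁺ʳ xs x∈))) λ q →
      proj₂ (proj₂ (Unique-++⁻ xs (Unique-resp-↭ p uz))) (subst (_∈ xs) (inv x) (cx q) , x∈)

-- Even and odd walks; operations on spiders

module Walks (G : Graph) where

  private
    Adj : V G → V G → Set
    Adj = Adjacent G
    variable
      a b p u v w x y z : V G
      L L′ I I′ R R′ X Y : List (V G)

  open CMSolver (++-commutativeMonoid {A = V G}) using (solve; _⊕_; _⊜_)

  Adjacent-sym : Adj u v → Adj v u
  Adjacent-sym (e , inj₁ j) = e , inj₂ j
  Adjacent-sym (e , inj₂ j) = e , inj₁ j

  Adjacent-irrefl : Adj u u → ⊥
  Adjacent-irrefl (e , inj₁ (s , t)) = loopless G e (trans s (sym t))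
  Adjacent-irrefl (e , inj₂ (s , t)) = loopless G e (trans s (sym t))

  -- Even length; the index lists the vertices other than the first one.
  data Even : V G → V G → List (V G) → Set where
    nil  : Even u u []
    step : Adj u a → Adj a b → Even b v L → Even u v (a ∷ b ∷ L)

  -- Odd length; the index lists the interior vertices.
  data Odd : V G → V G → List (V G) → Set where
    one  : Adj u v → Odd u v []
    step : Adj u a → Adj a b → Odd b v I → Odd u v (a ∷ b ∷ I)

  -- Arbitrary adjacent pairs are allowed rather than edges of one fixed matching, because discarded
  -- odd walks are paired along their own edges.
  data Matched : List (V G) → Set where
    []  : Matched []
    _∷_ : Adj u v → Matched R → Matched (u ∷ v ∷ R)

  Matched-++ : Matched R → Matched R′ → Matched (R ++ R′)
  Matched-++ []      m′ = m′
  Matched-++ (e ∷ m) m′ = e ∷ Matched-++ m m′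

  interior-matched : Odd u v I → Matched I
  interior-matched (one _)      = []
  interior-matched (step _ e p) = e ∷ interior-matched p

  infixr 5 _∙_ _∙ₒ_ _∷ˡ_ _∷ʳ_

  _∙_ : Even u w L → Even w v L′ → Even u v (L ++ L′)
  nil        ∙ q = q
  step e f p ∙ q = step e f (p ∙ q)

  _∷ʳ_ : Even u w L → Adj w v → Odd u v L
  nil        ∷ʳ g = one g
  step e f p ∷ʳ g = step e f (p ∷ʳ g)

  _∷ˡ_ : Adj u w → Odd w v I → Even u v (w ∷ I ++ [ v ])
  g ∷ˡ one e      = step g e nil
  g ∷ˡ step e f p = step g e (f ∷ˡ p)

  _∙ₒ_ : Odd u w I → Odd w v I′ → Even u v (I ++ w ∷ I′ ++ [ v ])
  one e      ∙ₒ q = e ∷ˡ q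
  step e f p ∙ₒ q = step e f (p ∙ₒ q)

  -- The index of `Even` omits the start, so the two lists agree only after each gets its own start
  -- back.
  reverse : Even u v L → ∃[ L′ ] (Even v u L′ × u ∷ L ↭ v ∷ L′)
  reverse nil = [] , nil , ↭-refl
  reverse {u = u} (step {a = a} {b = b} {v = v} e f p) with reverse p
  ... | L′ , q , perm = L′ ++ a ∷ u ∷ [] , q ∙ step (Adjacent-sym f) (Adjacent-sym e) nil ,
        ↭-trans (↭-prep u (↭-prep a perm))
          (solve 4 (λ u a v L → (u ⊕ (a ⊕ (v ⊕ L))) ⊜ (v ⊕ (L ⊕ (a ⊕ u)))) ↭-refl [ u ] [ a ] [ v ] L′)

  -- Adding a new vertex adjacent to b, v and u to the spider gives a
  -- bi-subdivision of Θ or of K₄; R is the part of X outside the spider.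
  data Spider (b v u : V G) (X : List (V G)) : Set where
    tree : ∀ {w L₁ L₂ L₃ R} →
           Even w b L₁ → Even w v L₂ → Even w u L₃ → Matched R →
           X ↭ w ∷ L₁ ++ L₂ ++ L₃ ++ R → Spider b v u X
    triangle : ∀ {w₁ w₂ w₃ L₁ L₂ L₃ I₁₂ I₁₃ I₂₃ R} →
           Even w₁ b L₁ → Even w₂ v L₂ → Even w₃ u L₃ →
           Odd w₁ w₂ I₁₂ → Odd w₁ w₃ I₁₃ → Odd w₂ w₃ I₂₃ → Matched R →
           X ↭ w₁ ∷ w₂ ∷ w₃ ∷ L₁ ++ L₂ ++ L₃ ++ I₁₂ ++ I₁₃ ++ I₂₃ ++ R → Spider b v u X

  -- Only the leg to the root grows: a common prefix split off from two walks is put back here.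
  extendRoot : Spider a v u X → Even a b L → Y ↭ X ++ L → Spider b v u Y
  extendRoot {L = L} (tree {w} {L₁} {L₂} {L₃} {R} l₁ l₂ l₃ m perm) l permY =
    tree (l₁ ∙ l) l₂ l₃ m (↭-trans permY (↭-trans (++⁺ʳ L perm)
      (solve 6 (λ w L₁ L₂ L₃ R L → ((w ⊕ (L₁ ⊕ (L₂ ⊕ (L₃ ⊕ R)))) ⊕ L)
                                 ⊜ (w ⊕ ((L₁ ⊕ L) ⊕ (L₂ ⊕ (L₃ ⊕ R)))))
        ↭-refl [ w ] L₁ L₂ L₃ R L)))
  extendRoot {L = L} (triangle {w₁} {w₂} {w₃} {L₁} {L₂} {L₃} {I₁₂} {I₁₃} {I₂₃} {R} l₁ l₂ l₃ s₁₂ s₁₃ s₂₃ m perm) l permY =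
    triangle (l₁ ∙ l) l₂ l₃ s₁₂ s₁₃ s₂₃ m (↭-trans permY (↭-trans (++⁺ʳ L perm)
      (solve 6 (λ w₁ w₂ w₃ L₁ S L → ((w₁ ⊕ (w₂ ⊕ (w₃ ⊕ (L₁ ⊕ S)))) ⊕ L)
                                  ⊜ (w₁ ⊕ (w₂ ⊕ (w₃ ⊕ ((L₁ ⊕ L) ⊕ S)))))
        ↭-refl [ w₁ ] [ w₂ ] [ w₃ ] L₁ (L₂ ++ L₃ ++ I₁₂ ++ I₁₃ ++ I₂₃ ++ R) L)))

  -- Joining the feet y and p through a new odd walk from x to z turns a tree
  -- into a triangle. A triangle becomes a tree: delete the interiors of its
  -- side w₂w₃ and of the new walk; this leaves two even legs from w₁.
  closeOff : Spider b y p X → Adj y z → Adj p x → Odd x z I → Even x v L → Even z u L′ →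
             Y ↭ X ++ x ∷ z ∷ I ++ L ++ L′ → Spider b v u Y
  closeOff {z = z} {x = x} {I = I} {L = L} {L′ = L′} (tree {w} {L₁} {L₂} {L₃} {R} l₁ l₂ l₃ m perm) yz px s l l′ permY =
    triangle l₁ l l′ (l₃ ∷ʳ px) (l₂ ∷ʳ yz) s m (↭-trans permY (↭-trans (++⁺ʳ _ perm)
      (solve 10 (λ w L₁ L₂ L₃ R x z I L L′ →
          ((w ⊕ (L₁ ⊕ (L₂ ⊕ (L₃ ⊕ R)))) ⊕ (x ⊕ (z ⊕ (I ⊕ (L ⊕ L′)))))
        ⊜ (w ⊕ (x ⊕ (z ⊕ (L₁ ⊕ (L ⊕ (L′ ⊕ (L₃ ⊕ (L₂ ⊕ (I ⊕ R))))))))))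
        ↭-refl [ w ] L₁ L₂ L₃ R [ x ] [ z ] I L L′)))
  closeOff {z = z} {x = x} {I = I} {L = L} {L′ = L′} (triangle {w₁} {w₂} {w₃} {L₁} {L₂} {L₃} {I₁₂} {I₁₃} {I₂₃} {R} l₁ l₂ l₃ s₁₂ s₁₃ s₂₃ m perm) yz px s l l′ permY =
    tree l₁ ((s₁₃ ∙ₒ (l₃ ∷ʳ px)) ∙ l) ((s₁₂ ∙ₒ (l₂ ∷ʳ yz)) ∙ l′)
      (Matched-++ (interior-matched s₂₃) (Matched-++ (interior-matched s) m))
      (↭-trans permY (↭-trans (++⁺ʳ _ perm)
      (solve 15 (λ w₁ w₂ w₃ L₁ L₂ L₃ I₁₂ I₁₃ I₂₃ R x z I L L′ →
          ((w₁ ⊕ (w₂ ⊕ (w₃ ⊕ (L₁ ⊕ (L₂ ⊕ (L₃ ⊕ (I₁₂ ⊕ (I₁₃ ⊕ (I₂₃ ⊕ R)))))))))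
             ⊕ (x ⊕ (z ⊕ (I ⊕ (L ⊕ L′)))))
        ⊜ (w₁ ⊕ (L₁ ⊕ (((I₁₃ ⊕ (w₃ ⊕ (L₃ ⊕ x))) ⊕ L)
             ⊕ (((I₁₂ ⊕ (w₂ ⊕ (L₂ ⊕ z))) ⊕ L′) ⊕ (I₂₃ ⊕ (I ⊕ R)))))))
        ↭-refl [ w₁ ] [ w₂ ] [ w₃ ] L₁ L₂ L₃ I₁₂ I₁₃ I₂₃ R [ x ] [ z ] I L L′)))

  -- Walks alternating with a fixed perfect matching; construction of the spider

  module Alternating (_≟_ : DecidableEquality (V G)) (mate : V G → V G)
                     (mate-involutive : ∀ v → mate (mate v) ≡ v)
                     (mate-adjacent : ∀ v → Adj v (mate v)) where

    open DecMembership _≟_ using (_∈?_)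

    private variable
      C D P Q U : List (V G)

    -- An alternating walk w₁ , mate w₁ , w₂ , mate w₂ , … is listed by its wᵢ;
    -- the step into wᵢ may use any edge.
    data Alt : V G → V G → List (V G) → Set where
      []  : Alt u u []
      _∷_ : Adj u w → Alt (mate w) v L → Alt u v (w ∷ L)

    vertices : List (V G) → List (V G)
    vertices []      = []
    vertices (w ∷ P) = w ∷ mate w ∷ vertices P

    vertices-++ : ∀ C D → vertices (C ++ D) ≡ vertices C ++ vertices D
    vertices-++ []      D = refl
    vertices-++ (w ∷ C) D = cong (λ L → w ∷ mate w ∷ L) (vertices-++ C D)

    ∈vertices-++⁺ˡ : ∀ {C} D → w ∈ vertices C → w ∈ vertices (C ++ D)
    ∈vertices-++⁺ˡ {w = w} {C = C} D p = subst (w ∈_) (sym (vertices-++ C D)) (∈-++⁺ˡ p)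

    ∈vertices-++⁺ʳ : ∀ C {D} → w ∈ vertices D → w ∈ vertices (C ++ D)
    ∈vertices-++⁺ʳ {w = w} C {D = D} p = subst (w ∈_) (sym (vertices-++ C D)) (∈-++⁺ʳ (vertices C) p)

    ∈vertices-++⁻ : ∀ C {D} → w ∈ vertices (C ++ D) → w ∈ vertices C ⊎ w ∈ vertices D
    ∈vertices-++⁻ {w = w} C {D = D} p = ∈-++⁻ (vertices C) (subst (w ∈_) (vertices-++ C D) p)

    vertices-closed : ∀ P → Closed mate (vertices P)
    vertices-closed (w ∷ P) (here refl)         = there (here refl)
    vertices-closed (w ∷ P) (there (here refl)) = here (mate-involutive w)
    vertices-closed (w ∷ P) (there (there p))   = there (there (vertices-closed P p))

    -- `P` lists the vertices at which it enters matching edges. The alternatives thus tell whether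
    -- a second walk entering its matching edge at `w` follows the direction of `P` or opposes it.
    ∈vertices⁻ : ∀ P → w ∈ vertices P → w ∈ P ⊎ mate w ∈ P
    ∈vertices⁻ (x ∷ P) (here refl) = inj₁ (here refl)
    ∈vertices⁻ (x ∷ P) (there (here refl)) = inj₂ (here (mate-involutive x))
    ∈vertices⁻ (x ∷ P) (there (there p)) = [ inj₁ ∘ there , inj₂ ∘ there ]′ (∈vertices⁻ P p)

    Avoids : List (V G) → List (V G) → Set
    Avoids Q = All λ w → w ∉ vertices Q

    -- Testing the entry vertices is enough, as `vertices Q` contains the mate of each of its
    -- members.
    Avoids⇒Disjoint : Avoids Q P → Disjoint (vertices P) (vertices Q)
    Avoids⇒Disjoint (n ∷ ns) (here refl , q) = n q
    Avoids⇒Disjoint {Q} (_∷_ {x = w} n ns) (there (here refl) , q) =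
      n (subst (_∈ vertices Q) (mate-involutive w) (vertices-closed Q q))
    Avoids⇒Disjoint (n ∷ ns) (there (there p) , q) = Avoids⇒Disjoint ns (p , q)

    firstMeeting : ∀ Q P → Avoids Q P ⊎
      (∃[ A ] ∃[ w ] ∃[ B ] (P ≡ A ++ w ∷ B × Avoids Q A × w ∈ vertices Q))
    firstMeeting Q [] = inj₁ []
    firstMeeting Q (w ∷ P) with w ∈? vertices Q
    ... | yes p = inj₂ ([] , w , P , refl , [] , p)
    ... | no n with firstMeeting Q P
    ...   | inj₁ av = inj₁ (n ∷ av)
    ...   | inj₂ (A , z , B , refl , av , p) = inj₂ (w ∷ A , z , B , refl , n ∷ av , p)

    lastMeeting : ∀ Q P → Avoids Q P ⊎
      (∃[ A ] ∃[ w ] ∃[ B ] (P ≡ A ++ w ∷ B × Avoids Q B × w ∈ vertices Q))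
    lastMeeting Q [] = inj₁ []
    lastMeeting Q (w ∷ P) with lastMeeting Q P
    ... | inj₂ (A , z , B , refl , av , p) = inj₂ (w ∷ A , z , B , refl , av , p)
    ... | inj₁ av with w ∈? vertices Q
    ...   | yes p = inj₂ ([] , w , P , refl , av , p)
    ...   | no n  = inj₁ (n ∷ av)

    splitAlt : ∀ A {w B} → Alt u v (A ++ w ∷ B) → ∃[ y ] (Alt u y A × Adj y w × Alt (mate w) v B)
    splitAlt []      (e ∷ q) = _ , [] , e , q
    splitAlt (x ∷ A) (e ∷ q) with splitAlt A q
    ... | y , q₁ , f , q₂ = y , e ∷ q₁ , f , q₂

    joinAlt : Alt u w C → Alt w v D → Alt u v (C ++ D)
    joinAlt []      q = q
    joinAlt (e ∷ p) q = e ∷ joinAlt p q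

    Alt⇒Even : Alt u v P → Even u v (vertices P)
    Alt⇒Even []      = nil
    Alt⇒Even (e ∷ p) = step e (mate-adjacent _) (Alt⇒Even p)

    private
      rotate : ∀ {s} → X ↭ y ∷ a ∷ I → x ∷ s ∷ X ↭ x ∷ a ∷ s ∷ y ∷ I
      rotate {y = y} {a = a} {I = I} {x = x} {s = s} perm = ↭-prep x (↭-trans (↭-prep s perm)
        (solve 4 (λ s y a I → (s ⊕ (y ⊕ (a ⊕ I))) ⊜ (a ⊕ (s ⊕ (y ⊕ I)))) ↭-refl [ s ] [ y ] [ a ] I))

    -- Started at `x` instead of `mate x`, the walk begins and ends with a matching edge, hence is
    -- odd; its interior is paired by the other edges.
    Alt⇒Odd : ∀ A {x D t B} → x ∷ D ≡ A ++ t ∷ B → Alt (mate x) v D →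
              ∃[ I ] (Odd x (mate t) I × vertices (A ++ [ t ]) ↭ x ∷ mate t ∷ I)
    Alt⇒Odd [] refl _ = [] , one (mate-adjacent _) , ↭-refl
    -- The rest of the prefix is split so that `D` is visibly nonempty and the alternating walk can
    -- be matched on.
    Alt⇒Odd (x ∷ []) refl (e ∷ q) with Alt⇒Odd [] refl q
    ... | I , p , perm = _ , step (mate-adjacent x) e p , rotate perm
    Alt⇒Odd (x ∷ A@(_ ∷ _)) refl (e ∷ q) with Alt⇒Odd A refl q
    ... | I , p , perm = _ , step (mate-adjacent x) e p , rotate perm

    -- The start of a walk is not among its `vertices`; in the uses it lies outside `U`.
    Fits : List (V G) → List (V G) → Set
    Fits U P = Unique (vertices P) × vertices P ⊆ U

    Fits-++⁻ : ∀ C {D} → Fits U (C ++ D) → Fits U C × Fits U D × Disjoint (vertices C) (vertices D)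
    Fits-++⁻ C {D} (u , sub) rewrite vertices-++ C D with Unique-++⁻ (vertices C) u
    ... | uC , uD , dis = (uC , sub ∘ ∈-++⁺ˡ) , (uD , sub ∘ ∈-++⁺ʳ (vertices C)) , dis

    Fits-++⁺ : Fits U C → Fits U D → Disjoint (vertices C) (vertices D) → Fits U (C ++ D)
    Fits-++⁺ {C = C} {D = D} (uC , sC) (uD , sD) dis rewrite vertices-++ C D =
      UniqueProps.++⁺ uC uD dis , λ p → [ sC , sD ]′ (∈-++⁻ (vertices C) p)

    record Complement (U P : List (V G)) : Set where
      field
        U′         : List (V G)
        perm       : U ↭ vertices P ++ U′
        unique     : Unique U′
        mateClosed : Closed mate U′
        restrict   : Fits U Q → Disjoint (vertices Q) (vertices P) → Fits U′ Q

    complement : Unique U → Closed mate U → Fits U P → Complement U P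
    complement {U} {P} uU cU (uP , sP) with Unique⇒complement (vertices P) uP sP
    ... | U′ , perm = record
      { U′ = U′ ; perm = perm
      ; unique = proj₁ (proj₂ (Unique-++⁻ (vertices P) (Unique-resp-↭ perm uU)))
      ; mateClosed = complement-closed mate-involutive perm uU cU (vertices-closed P)
      ; restrict = λ (uQ , sQ) dis → uQ , λ q → complement-∈ perm (sQ q) λ p → dis (q , p)
      }

    Fits-mates : Closed mate U → w ∈ U → Fits U [ w ]
    Fits-mates {U = U} {w = w} cU w∈ = (w≢mate ∷ []) ∷ [] ∷ [] , λ where
        (here refl)         → w∈
        (there (here refl)) → cU w∈
      where
      w≢mate : w ≢ mate w
      w≢mate eq = Adjacent-irrefl (subst (Adj w) (sym eq) (mate-adjacent w))

    Closed⇒Matched : ∀ U → Unique U → Closed mate U → ∃[ R ] (U ↭ R × Matched R)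
    Closed⇒Matched U = go U (<-wellFounded (length U))
      where
      go : ∀ U → Acc _<_ (length U) → Unique U → Closed mate U → ∃[ R ] (U ↭ R × Matched R)
      go [] _ _ _ = [] , ↭-refl , []
      go (w ∷ U) (acc rec) uU cU with go U′ (rec shorter) unique mateClosed
        where
        open Complement (complement uU cU (Fits-mates cU (here refl)))
        shorter : length U′ < length (w ∷ U)
        shorter = ≤-trans (n≤1+n _) (≤-reflexive (sym (↭-length perm)))
      ... | R , permR , m = w ∷ mate w ∷ R , ↭-trans perm (↭-prep w (↭-prep _ permR)) , mate-adjacent w ∷ m
        where open Complement (complement uU cU (Fits-mates cU (here refl)))

    -- Following `mate` and a second perfect matching alternately from v, the
    -- walk can only get stuck at the other matching's partner of c.
    alternatingWalk : (mate′ : V G → V G) → (∀ v → mate′ (mate′ v) ≡ v) → (∀ v → Adj v (mate′ v)) →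
                      ∀ {c v U} → Unique (c ∷ v ∷ U) → Closed mate U → Closed mate′ (c ∷ v ∷ U) →
                      ∃[ P ] (Alt v (mate′ c) P × Fits U P)
    alternatingWalk mate′ inv adj {c} = go (<-wellFounded _)
      where
      go : ∀ {v U} → Acc _<_ (length U) → Unique (c ∷ v ∷ U) → Closed mate U → Closed mate′ (c ∷ v ∷ U) →
           ∃[ P ] (Alt v (mate′ c) P × Fits U P)
      go {v} {U} (acc rec) u@(_ ∷ _ ∷ uU) cU c′ with v ≟ mate′ c
      -- At the outset this case means that the two claw edges are parallel; an empty walk is then
      -- correct.
      ... | yes refl = [] , [] , [] , λ ()
      ... | no v≢ = v₁ ∷ proj₁ next , adj v ∷ proj₁ (proj₂ next) ,
                    Fits-++⁺ fits (proj₁ fitsU′ , λ p → ∈-resp-↭ (↭-sym perm) (there (there (proj₂ fitsU′ p))))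
                      (λ (p , q) → proj₂ (proj₂ (Unique-++⁻ (vertices [ v₁ ]) (Unique-resp-↭ perm uU))) (p , proj₂ fitsU′ q))
        where
        v₁ : V G
        v₁ = mate′ v
        v₁∈U : v₁ ∈ U
        v₁∈U with c′ (there (here refl))
        ... | here v₁≡c = ⊥-elim (v≢ (trans (sym (inv v)) (cong mate′ v₁≡c)))
        ... | there (here v₁≡v) = ⊥-elim (Adjacent-irrefl (subst (Adj v) v₁≡v (adj v)))
        ... | there (there p) = p
        fits = Fits-mates cU v₁∈U
        open Complement (complement uU cU fits)
        -- Once `v` and `v₁` leave, `c` and the next position `mate v₁` are again the only two
        -- vertices outside the `mate`-closed rest, which restores the invariant.
        rearranged : c ∷ v ∷ U ↭ (v ∷ v₁ ∷ []) ++ (c ∷ mate v₁ ∷ U′)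
        rearranged = ↭-trans (↭-prep c (↭-prep v perm))
          (solve 5 (λ c v v₁ m U → (c ⊕ (v ⊕ (v₁ ⊕ (m ⊕ U)))) ⊜ ((v ⊕ v₁) ⊕ (c ⊕ (m ⊕ U))))
            ↭-refl [ c ] [ v ] [ v₁ ] [ mate v₁ ] U′)
        closedPair : Closed mate′ (v ∷ v₁ ∷ [])
        closedPair (here refl)         = there (here refl)
        closedPair (there (here refl)) = here (inv v)
        next : ∃[ P ] (Alt (mate v₁) (mate′ c) P × Fits U′ P)
        next = go (rec (≤-trans (n≤1+n _) (≤-reflexive (sym (↭-length perm)))))
                 (proj₁ (proj₂ (Unique-++⁻ (v ∷ v₁ ∷ []) (Unique-resp-↭ rearranged u)))) mateClosed
                 (complement-closed inv rearranged u c′ closedPair)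
        fitsU′ = proj₂ (proj₂ next)

    -- Where Q meets P for the last time, at w, it runs along the edge w, mate w
    -- either as P does, or against P (x₀ = mate w being the entry of P).
    -- In the latter case let z be the first vertex of Q on the part of P from x₀ on.
    -- If Q enters that part in the direction of P, then Q up to mate z can be
    -- split off as a common prefix; otherwise the initial pieces of P and Q
    -- that stay clear of that part give a smaller spider, which is closed off.
    spider : Acc _<_ (length P) → Unique U → Closed mate U →
             Alt b u P → Fits U P → Alt b v Q → Fits U Q → Spider b v u (b ∷ U)
    spider {P = P} {U = U} {b = b} {Q = Q} _ uU cU p fP q fQ with lastMeeting P Q
    ... | inj₁ av = tree nil (Alt⇒Even q) (Alt⇒Even p) matched
            (↭-prep b (↭-trans perm (↭-trans (++⁺ʳ _ (↭-reflexive (vertices-++ Q P)))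
              (↭-trans (↭-reflexive (++-assoc (vertices Q) (vertices P) _))
                (++⁺ˡ (vertices Q) (++⁺ˡ (vertices P) permR))))))
      where
      open Complement (complement {P = Q ++ P} uU cU (Fits-++⁺ fQ fP (Avoids⇒Disjoint av)))
      rest    = Closed⇒Matched U′ unique mateClosed
      permR   = proj₁ (proj₂ rest)
      matched = proj₂ (proj₂ rest)
    ... | inj₂ (A , w , B , refl , av , w∈) with ∈vertices⁻ P w∈
    spider {U = U} {b = b} _ uU cU p fP q fQ
        | inj₂ (A , w , B , refl , av , w∈) | inj₁ w∈P with ∈-∃++ w∈P
    ... | C , D , refl with splitAlt C p | splitAlt A q
    ... | _ , p₁ , e , p₂ | _ , _ , _ , q₂ with reverse (Alt⇒Even (joinAlt p₁ (e ∷ [])))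
    -- The centre is the far end of the last common matching edge. Its legs are `P` backwards to `b`
    -- and the tails of `Q` and `P`; what `A` visits off `P` falls into the rest.
    ... | L , r , permL = tree r (Alt⇒Even q₂) (Alt⇒Even p₂) matched (begin
        b ∷ U ↭⟨ ↭-prep b perm ⟩
        b ∷ vertices (B ++ C ++ w ∷ D) ++ U′
          ≡⟨ cong (λ xs → b ∷ xs ++ U′) (trans (vertices-++ B _) (cong (vertices B ++_)
               (trans (cong vertices (sym (++-assoc C [ w ] D))) (vertices-++ (C ++ [ w ]) D)))) ⟩
        b ∷ (vertices B ++ vertices (C ++ [ w ]) ++ vertices D) ++ U′
          ↭⟨ ↭-prep b (++⁺ˡ _ permR) ⟩
        b ∷ (vertices B ++ vertices (C ++ [ w ]) ++ vertices D) ++ proj₁ rest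
          ↭⟨ solve 5 (λ b B C D R → (b ⊕ ((B ⊕ (C ⊕ D)) ⊕ R)) ⊜ ((b ⊕ C) ⊕ (B ⊕ (D ⊕ R)))) ↭-refl
               [ b ] (vertices B) (vertices (C ++ [ w ])) (vertices D) (proj₁ rest) ⟩
        (b ∷ vertices (C ++ [ w ])) ++ vertices B ++ vertices D ++ proj₁ rest
          ↭⟨ ++⁺ʳ _ permL ⟩
        mate w ∷ L ++ vertices B ++ vertices D ++ proj₁ rest ∎)
      where
      open PermutationReasoning
      fB = proj₁ (proj₂ (Fits-++⁻ [ w ] (proj₁ (proj₂ (Fits-++⁻ A fQ)))))
      open Complement (complement {P = B ++ C ++ w ∷ D} uU cU (Fits-++⁺ fB fP (Avoids⇒Disjoint av)))
      rest    = Closed⇒Matched U′ unique mateClosed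
      permR   = proj₁ (proj₂ rest)
      matched = proj₂ (proj₂ rest)
    spider {P = P} {U = U} {b = b} {u = u} {v = v} (acc rec) uU cU p fP q fQ
        | inj₂ (A , w , B , refl , av , w∈) | inj₂ x∈P with ∈-∃++ x∈P
    ... | C , D , refl with splitAlt C p | splitAlt A q
    ... | c , p₁ , e , p₂ | _ , q₁ , f , q₂ = meet (firstMeeting (x₀ ∷ D) (A ++ [ w ]))
      where
      x₀ : V G
      x₀ = mate w
      fQ′ : Fits U ((A ++ [ w ]) ++ B)
      fQ′ = subst (Fits U) (sym (++-assoc A [ w ] B)) fQ
      fC  = proj₁ (Fits-++⁻ C fP)
      fxD = proj₁ (proj₂ (Fits-++⁻ C fP))

      -- Beyond `mate z` the walks `D₂` and `A₂ ++ B` may still meet, which the recursion resolves.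
      -- The stretch of `P` before `z` is given up in favour of `Q`, so the new `P` is shorter.
      splitOff : ∀ A₁ {z A₂ D₁ D₂} → A ++ [ w ] ≡ A₁ ++ z ∷ A₂ → Avoids (x₀ ∷ D) A₁ →
                 x₀ ∷ D ≡ D₁ ++ z ∷ D₂ → Spider b v u (b ∷ U)
      splitOff A₁ {z} {A₂} {D₁} {D₂} eqA av₁ eqD
        with splitAlt A₁ (subst (Alt b x₀) eqA (joinAlt q₁ (f ∷ []))) | splitAlt D₁ (subst (Alt c u) eqD (e ∷ p₂))
      ... | y , qa , g , qb | _ , _ , _ , pD₂ with reverse (Alt⇒Even (joinAlt qa (g ∷ [])))
      ... | L , r , permL = extendRoot
              (spider (rec shorter) unique mateClosed pD₂ (restrict fD₂ disD₂) (joinAlt qb q₂) (restrict fA₂B disA₂B)) r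
              (begin
        b ∷ U ↭⟨ ↭-prep b perm ⟩
        (b ∷ vertices (A₁ ++ [ z ])) ++ U′ ↭⟨ ++⁺ʳ U′ permL ⟩
        (mate z ∷ L) ++ U′ ↭⟨ ↭-prep (mate z) (++-comm L U′) ⟩
        mate z ∷ U′ ++ L ∎)
        where
        open PermutationReasoning
        fD = Fits-++⁻ D₁ (subst (Fits U) eqD fxD)
        fzD₂ = Fits-++⁻ [ z ] (proj₁ (proj₂ fD))
        fD₂ = proj₁ (proj₂ fzD₂)
        fA : Fits U ((A₁ ++ [ z ]) ++ A₂ ++ B)
        fA = subst (Fits U) (trans (cong (_++ B) (trans eqA (sym (++-assoc A₁ [ z ] A₂)))) (++-assoc (A₁ ++ [ z ]) A₂ B)) fQ′
        fA₂B = proj₁ (proj₂ (Fits-++⁻ (A₁ ++ [ z ]) fA))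
        open Complement (complement uU cU (proj₁ (Fits-++⁻ (A₁ ++ [ z ]) fA)))
        disA₂B : Disjoint (vertices (A₂ ++ B)) (vertices (A₁ ++ [ z ]))
        disA₂B (s , t) = proj₂ (proj₂ (Fits-++⁻ (A₁ ++ [ z ]) fA)) (t , s)
        D₂⊆x₀D : vertices D₂ ⊆ vertices (x₀ ∷ D)
        D₂⊆x₀D {s} s∈ = subst (λ L → s ∈ vertices L) (sym eqD) (∈vertices-++⁺ʳ D₁ (there (there s∈)))
        disD₂ : Disjoint (vertices D₂) (vertices (A₁ ++ [ z ]))
        disD₂ (s∈ , t∈) with ∈vertices-++⁻ A₁ t∈
        ... | inj₁ s∈A₁ = Avoids⇒Disjoint av₁ (s∈A₁ , D₂⊆x₀D s∈)
        ... | inj₂ s∈z  = proj₂ (proj₂ fzD₂) (s∈z , s∈)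
        shorter : length D₂ < length (C ++ x₀ ∷ D)
        shorter rewrite eqD | sym (++-assoc C D₁ (z ∷ D₂)) | length-++ (C ++ D₁) {z ∷ D₂} = m≤n+m _ (length (C ++ D₁))

      -- Since `z` is entered against `P`, following `P` from `x₀` through `mate z` ends at `z`
      -- after an odd walk. The walks along `C` and `A₁` end at neighbours of `x₀` and `z`; they may
      -- meet each other, but not this walk or the tails `B` and `D₂`, which become the legs to `v`
      -- and `u`.
      close : ∀ A₁ {z A₂ D₁ D₂} → A ++ [ w ] ≡ A₁ ++ z ∷ A₂ → Avoids (x₀ ∷ D) A₁ →
              x₀ ∷ D ≡ D₁ ++ mate z ∷ D₂ → Spider b v u (b ∷ U)
      close A₁ {z} {A₂} {D₁} {D₂} eqA av₁ eqD
        with splitAlt A₁ (subst (Alt b x₀) eqA (joinAlt q₁ (f ∷ []))) | splitAlt D₁ (subst (Alt c u) eqD (e ∷ p₂))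
           | Alt⇒Odd D₁ eqD p₂
      ... | y , qa , g , _ | _ , _ , _ , pD₂ | I , s , permI = closeOff
              (spider (rec shorter) unique mateClosed p₁ (restrict fC disC) qa (restrict fA₁ disA₁))
              (subst (Adj y) (sym (mate-involutive z)) g) e s (Alt⇒Even q₂) (Alt⇒Even pD₂)
              (↭-prep b (begin
        U ↭⟨ perm ⟩
        vertices ((x₀ ∷ D) ++ B) ++ U′
          ≡⟨ cong (_++ U′) (trans (vertices-++ (x₀ ∷ D) B) (cong (_++ vertices B) (trans (cong vertices
               (trans eqD (sym (++-assoc D₁ [ mate z ] D₂)))) (vertices-++ (D₁ ++ [ mate z ]) D₂)))) ⟩
        ((vertices (D₁ ++ [ mate z ]) ++ vertices D₂) ++ vertices B) ++ U′
          ↭⟨ ++⁺ʳ U′ (++⁺ʳ (vertices B) (++⁺ʳ (vertices D₂) permI)) ⟩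
        (((x₀ ∷ mate (mate z) ∷ I) ++ vertices D₂) ++ vertices B) ++ U′
          ↭⟨ solve 4 (λ S D B U → (((S ⊕ D) ⊕ B) ⊕ U) ⊜ (U ⊕ (S ⊕ (B ⊕ D)))) ↭-refl
               (x₀ ∷ mate (mate z) ∷ I) (vertices D₂) (vertices B) U′ ⟩
        U′ ++ x₀ ∷ mate (mate z) ∷ I ++ vertices B ++ vertices D₂ ∎))
        where
        open PermutationReasoning
        fA : Fits U (A₁ ++ (z ∷ A₂) ++ B)
        fA = subst (Fits U) (trans (cong (_++ B) eqA) (++-assoc A₁ (z ∷ A₂) B)) fQ′
        fA₁ = proj₁ (Fits-++⁻ A₁ fA)
        fB = proj₁ (proj₂ (Fits-++⁻ (A ++ [ w ]) fQ′))
        B#P : Disjoint (vertices B) (vertices (C ++ x₀ ∷ D))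
        B#P = Avoids⇒Disjoint av
        xD#B : Disjoint (vertices (x₀ ∷ D)) (vertices B)
        xD#B (s∈ , t∈) = B#P (t∈ , ∈vertices-++⁺ʳ C s∈)
        open Complement (complement {P = (x₀ ∷ D) ++ B} uU cU (Fits-++⁺ fxD fB xD#B))
        disC : Disjoint (vertices C) (vertices ((x₀ ∷ D) ++ B))
        disC (s∈ , t∈) with ∈vertices-++⁻ (x₀ ∷ D) t∈
        ... | inj₁ t = proj₂ (proj₂ (Fits-++⁻ C fP)) (s∈ , t)
        ... | inj₂ t = B#P (t , ∈vertices-++⁺ˡ (x₀ ∷ D) s∈)
        disA₁ : Disjoint (vertices A₁) (vertices ((x₀ ∷ D) ++ B))
        disA₁ (s∈ , t∈) with ∈vertices-++⁻ (x₀ ∷ D) t∈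
        ... | inj₁ t = Avoids⇒Disjoint av₁ (s∈ , t)
        ... | inj₂ t = proj₂ (proj₂ (Fits-++⁻ A₁ fA))
                         (s∈ , ∈vertices-++⁺ʳ (z ∷ A₂) t)
        shorter : length C < length (C ++ x₀ ∷ D)
        shorter rewrite length-++ C {x₀ ∷ D} = m<m+n (length C) (s≤s z≤n)

      meet : Avoids (x₀ ∷ D) (A ++ [ w ]) ⊎
             (∃[ A₁ ] ∃[ z ] ∃[ A₂ ] (A ++ [ w ] ≡ A₁ ++ z ∷ A₂ × Avoids (x₀ ∷ D) A₁ × z ∈ vertices (x₀ ∷ D))) →
             Spider b v u (b ∷ U)
      -- A meeting exists because `w`, the last entry of the searched list, is the mate of `x₀`.
      meet (inj₁ av′) = ⊥-elim (All.lookup av′ (∈-insert A) (there (here (sym (mate-involutive w)))))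
      meet (inj₂ (A₁ , z , A₂ , eqA , av₁ , z∈)) with ∈vertices⁻ (x₀ ∷ D) z∈
      ... | inj₁ z∈D with ∈-∃++ z∈D
      ...   | D₁ , D₂ , eqD = splitOff A₁ {A₂ = A₂} {D₁ = D₁} eqA av₁ eqD
      meet (inj₂ (A₁ , z , A₂ , eqA , av₁ , z∈)) | inj₂ t∈D with ∈-∃++ t∈D
      ...   | D₁ , D₂ , eqD = close A₁ {A₂ = A₂} {D₁ = D₁} eqA av₁ eqD

    spiderAt : ∀ {Vs} → Unique Vs → (∀ v → v ∈ Vs) →
               (mate₂ : V G → V G) → (∀ v → mate₂ (mate₂ v) ≡ v) → (∀ v → Adj v (mate₂ v)) →
               (mate₃ : V G → V G) → (∀ v → mate₃ (mate₃ v) ≡ v) → (∀ v → Adj v (mate₃ v)) →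
               ∀ c → ∃[ X ] (Spider (mate c) (mate₃ c) (mate₂ c) X × Unique (c ∷ X) × (∀ v → v ∈ c ∷ X))
    spiderAt uVs complete mate₂ inv₂ adj₂ mate₃ inv₃ adj₃ c =
      _ , spider (<-wellFounded _) unique mateClosed (proj₁ (proj₂ walk₂)) (proj₂ (proj₂ walk₂))
                                                     (proj₁ (proj₂ walk₃)) (proj₂ (proj₂ walk₃)) ,
      Unique-resp-↭ perm uVs , ∈-resp-↭ perm ∘ complete
      where
      open Complement (complement uVs (λ _ → complete _) (Fits-mates (λ _ → complete _) (complete c)))
      walk₂ = alternatingWalk mate₂ inv₂ adj₂ (Unique-resp-↭ perm uVs) mateClosed (λ _ → ∈-resp-↭ perm (complete _))
      walk₃ = alternatingWalk mate₃ inv₃ adj₃ (Unique-resp-↭ perm uVs) mateClosed (λ _ → ∈-resp-↭ perm (complete _))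

-- Images of injections as Boolean subsets

Σ-T-≡ : {A : Set} {P : A → Bool} {x y : Σ[ a ∈ A ] T (P a)} → proj₁ x ≡ proj₁ y → x ≡ y
Σ-T-≡ {x = a , p} {y = _ , q} refl = cong (a ,_) (T-irrelevant p q)

Unique-map⇒injective : {A B : Set} (f : A → B) {xs : List A} → Unique (map f xs) →
                       ∀ {x y} → x ∈ xs → y ∈ xs → f x ≡ f y → x ≡ y
Unique-map⇒injective f (_ ∷ _)  (here refl) (here refl) _  = refl
Unique-map⇒injective f (n ∷ _)  (here refl) (there q)   eq = ⊥-elim (All.lookup n (∈-map⁺ f q) eq)
Unique-map⇒injective f (n ∷ _)  (there p) (here refl)   eq = ⊥-elim (All.lookup n (∈-map⁺ f p) (sym eq))
Unique-map⇒injective f (_ ∷ u)  (there p) (there q)     eq = Unique-map⇒injective f u p q eq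

module Image {A B : Set} (_≟_ : DecidableEquality B) (f : A → B) (injective : ∀ {x y} → f x ≡ f y → x ≡ y)
             (xs : List A) (complete : ∀ x → x ∈ xs) where

  open DecMembership _≟_ using (_∈?_)

  isImage : B → Bool
  isImage b = ⌊ b ∈? map f xs ⌋

  isImage⁺ : ∀ x → T (isImage (f x))
  isImage⁺ x = fromWitness (∈-map⁺ f (complete x))

  preimage : (b : Σ[ b ∈ B ] T (isImage b)) → ∃[ x ] proj₁ b ≡ f x
  preimage (b , p) with ∈-map⁻ f (toWitness p)
  ... | x , _ , eq = x , eq

  image↔ : (Σ[ b ∈ B ] T (isImage b)) ↔ A
  image↔ = mk↔ₛ′ (proj₁ ∘ preimage) (λ x → f x , isImage⁺ x)
    (λ x → injective (sym (proj₂ (preimage (f x , isImage⁺ x)))))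
    (λ b → Σ-T-≡ (sym (proj₂ (preimage b))))

-- Edges of matchings and edges along odd walks

module _ (G : Graph) where

  open Walks G

  private variable
    u v : V G
    I R : List (V G)

  Joins-sym : ∀ {e} → Joins G e u v → Joins G e v u
  Joins-sym (inj₁ j) = inj₂ j
  Joins-sym (inj₂ j) = inj₁ j

  Joins-ends : ∀ {e e′ u v u′ v′} → e ≡ e′ → Joins G e u v → Joins G e′ u′ v′ →
               (u ≡ u′ × v ≡ v′) ⊎ (u ≡ v′ × v ≡ u′)
  Joins-ends refl (inj₁ (refl , refl)) (inj₁ (p , q)) = inj₁ (p , q)
  Joins-ends refl (inj₁ (refl , refl)) (inj₂ (p , q)) = inj₂ (p , q)
  Joins-ends refl (inj₂ (refl , refl)) (inj₁ (p , q)) = inj₂ (q , p)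
  Joins-ends refl (inj₂ (refl , refl)) (inj₂ (p , q)) = inj₁ (q , p)

  matchedEdges : Matched R → List (E G)
  matchedEdges []            = []
  matchedEdges ((e , _) ∷ m) = e ∷ matchedEdges m

  matchedEdges-cover : (m : Matched R) → v ∈ R → ∃[ e ] (e ∈ matchedEdges m × Incident G e v)
  matchedEdges-cover ((e , inj₁ (s , _)) ∷ m) (here refl) = e , here refl , inj₁ s
  matchedEdges-cover ((e , inj₂ (_ , t)) ∷ m) (here refl) = e , here refl , inj₂ t
  matchedEdges-cover ((e , inj₁ (_ , t)) ∷ m) (there (here refl)) = e , here refl , inj₂ t
  matchedEdges-cover ((e , inj₂ (s , _)) ∷ m) (there (here refl)) = e , here refl , inj₁ s
  matchedEdges-cover (_ ∷ m) (there (there p)) with matchedEdges-cover m p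
  ... | e , e∈ , inc = e , there e∈ , inc

  Joins-incident : ∀ {e w} → Joins G e u v → Incident G e w → w ≡ u ⊎ w ≡ v
  Joins-incident (inj₁ (refl , refl)) (inj₁ p) = inj₁ (sym p)
  Joins-incident (inj₁ (refl , refl)) (inj₂ p) = inj₂ (sym p)
  Joins-incident (inj₂ (refl , refl)) (inj₁ p) = inj₂ (sym p)
  Joins-incident (inj₂ (refl , refl)) (inj₂ p) = inj₁ (sym p)

  matchedEdges-ends : ∀ {e} (m : Matched R) → e ∈ matchedEdges m → Incident G e v → v ∈ R
  matchedEdges-ends ((_ , j) ∷ m) (here refl) inc with Joins-incident j inc
  ... | inj₁ refl = here refl
  ... | inj₂ refl = there (here refl)
  matchedEdges-ends (_ ∷ m) (there p) inc = there (there (matchedEdges-ends m p inc))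

  matchedEdges-unique : ∀ {e e′} (m : Matched R) → Unique R → e ∈ matchedEdges m → e′ ∈ matchedEdges m →
                        Incident G e v → Incident G e′ v → e ≡ e′
  matchedEdges-unique (_ ∷ _) _ (here refl) (here refl) _ _ = refl
  matchedEdges-unique {R = x ∷ y ∷ R} ((_ , j) ∷ m) u (here refl) (there q) i i′ =
    ⊥-elim (proj₂ (proj₂ (Unique-++⁻ (x ∷ y ∷ []) u))
      ([ here , there ∘ here ]′ (Joins-incident j i) , matchedEdges-ends m q i′))
  matchedEdges-unique {R = x ∷ y ∷ R} ((_ , j) ∷ m) u (there p) (here refl) i i′ =
    ⊥-elim (proj₂ (proj₂ (Unique-++⁻ (x ∷ y ∷ []) u))
      ([ here , there ∘ here ]′ (Joins-incident j i′) , matchedEdges-ends m p i))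
  matchedEdges-unique (_ ∷ m) (_ ∷ _ ∷ u) (there p) (there q) i i′ = matchedEdges-unique m u p q i i′

  -- The numbering is that of the edges of `subdivide`, with `length I` subdivision vertices.
  edgeAt : Odd u v I → Fin (suc (length I)) → E G
  edgeAt (one (e , _))      zero          = e
  edgeAt (step (e , _) _ _) zero          = e
  edgeAt (step _ (e , _) _) (suc zero)    = e
  edgeAt (step _ _ p)       (suc (suc i)) = edgeAt p i

  lastEdge : Odd u v I → E G
  lastEdge p = edgeAt p (fromℕ _)

  before : V G → (I : List (V G)) → Fin (suc (length I)) → V G
  before u I zero    = u
  before u I (suc i) = lookup I i

  after : V G → (I : List (V G)) {i : Fin (suc (length I))} → View i → V G
  after v I ‵fromℕ       = v
  after v I (‵inject₁ i) = lookup I i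

  after-∷ : ∀ v x I (i : Fin (suc (length I))) → after v (x ∷ I) (view (suc i)) ≡ after v I (view i)
  after-∷ v x I i with view i
  ... | ‵fromℕ     = refl
  ... | ‵inject₁ _ = refl

  edgeAt-joins : (p : Odd u v I) (i : Fin (suc (length I))) →
                 Joins G (edgeAt p i) (before u I i) (after v I (view i))
  edgeAt-joins (one (_ , j)) zero = j
  edgeAt-joins (step (_ , j) _ _) zero = j
  edgeAt-joins (step _ (_ , j) _) (suc zero) = j
  edgeAt-joins {v = v} (step {a = a} {b = b} {I = I} _ _ p) (suc (suc i))
    rewrite after-∷ v a (b ∷ I) (suc i) | after-∷ v b I i with edgeAt-joins p i
  -- The two cases differ only in how `before` computes.
  edgeAt-joins (step _ _ p) (suc (suc zero)) | j = j
  edgeAt-joins (step _ _ p) (suc (suc (suc i))) | j = j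

  Odd-interior-even : Odd u v I → 2 ∣ length I
  Odd-interior-even (one _)      = 2 ∣0
  Odd-interior-even (step _ _ p) = ∣m∣n⇒∣m+n ∣-refl (Odd-interior-even p)

-- Embedding a bi-subdivision as a conformal subgraph

-- Two edges of the subdivision can have the same ends only if they are parallel
-- edges of J that are not subdivided; hence `parallel-injective`.
module Realize
  (G : Graph) (_≟V_ : DecidableEquality (V G)) (_≟E_ : DecidableEquality (E G))
  (J : Graph) (Vs : List (V J)) (Vs-complete : ∀ v → v ∈ Vs) (Es : List (E J)) (Es-complete : ∀ e → e ∈ Es)
  (noAntiparallel : ∀ e e′ → src J e ≡ tgt J e′ → tgt J e ≢ src J e′)
  (branch : V J → V G) (interior : E J → List (V G))
  (path : ∀ e → Walks.Odd G (branch (src J e)) (branch (tgt J e)) (interior e))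
  (parallel-injective : ∀ e e′ → src J e ≡ src J e′ → tgt J e ≡ tgt J e′ →
                        lastEdge G (path e) ≡ lastEdge G (path e′) → e ≡ e′)
  {R : List (V G)} (matched : Walks.Matched G R)
  (unique : Unique ((map branch Vs ++ concatMap interior Es) ++ R))
  (complete : ∀ v → v ∈ (map branch Vs ++ concatMap interior Es) ++ R)
  where

  open DecMembership _≟E_ using (_∈?_)

  private
    s : E J → ℕ
    s e = length (interior e)

    J′ : Graph
    J′ = subdivide J s

    φ : V J′ → V G
    φ (inj₁ v)       = branch v
    φ (inj₂ (e , i)) = lookup (interior e) i

    ε : E J′ → E G
    ε (e , i) = edgeAt G (path e) i

    interiors : E J → List (V J′)
    interiors e = tabulate λ i → inj₂ (e , i)

    V′s : List (V J′)
    V′s = map inj₁ Vs ++ concatMap interiors Es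

    E′s : List (E J′)
    E′s = concatMap (λ e → map (e ,_) (allFin (suc (s e)))) Es

    V′s-complete : ∀ v → v ∈ V′s
    V′s-complete (inj₁ v)       = ∈-++⁺ˡ (∈-map⁺ inj₁ (Vs-complete v))
    V′s-complete (inj₂ (e , i)) = ∈-++⁺ʳ (map inj₁ Vs) (∈-concatMap⁺ interiors (lose (Es-complete e) (∈-tabulate⁺ i)))

    E′s-complete : ∀ e → e ∈ E′s
    E′s-complete (e , i) = ∈-concatMap⁺ _ (lose (Es-complete e) (∈-map⁺ (e ,_) (∈-allFin i)))

    -- Through this equation the absence of repetitions among the listed vertices of `G` becomes
    -- injectivity of `φ`.
    φ-V′s : map φ V′s ≡ map branch Vs ++ concatMap interior Es
    φ-V′s = trans (map-++ φ (map inj₁ Vs) _) (cong₂ _++_ (sym (map-∘ Vs))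
      (trans (map-concatMap φ interiors Es) (concatMap-cong (λ e →
        trans (map-tabulate _ φ) (tabulate-lookup (interior e))) Es)))

    unique′ : Unique (map φ V′s) × Unique R × Disjoint (map φ V′s) R
    unique′ = Unique-++⁻ (map φ V′s) (subst (λ xs → Unique (xs ++ R)) (sym φ-V′s) unique)

    φ-injective : ∀ {x y} → φ x ≡ φ y → x ≡ y
    φ-injective = Unique-map⇒injective φ (proj₁ unique′) (V′s-complete _) (V′s-complete _)

    φ-src : ∀ e i → φ (pathSrc J s e i) ≡ before G (branch (src J e)) (interior e) i
    φ-src e zero    = refl
    φ-src e (suc i) = refl

    φ-tgt : ∀ e {i} (w : View i) → φ (pathTgt J s e w) ≡ after G (branch (tgt J e)) (interior e) w
    φ-tgt e ‵fromℕ       = refl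
    φ-tgt e (‵inject₁ _) = refl

    ε-joins : ∀ k → Joins G (ε k) (φ (src J′ k)) (φ (tgt J′ k))
    ε-joins (e , i) rewrite φ-src e i | φ-tgt e (view i) = edgeAt-joins G (path e) i

    -- The view is recast as equations so that `i` can still be matched on; `last` keeps
    -- `i ≡ fromℕ (s e)` to connect with `lastEdge`.
    data Target (e : E J) (i : Fin (suc (s e))) (x : V J′) : Set where
      last  : i ≡ fromℕ (s e) → x ≡ inj₁ (tgt J e) → Target e i x
      inner : ∀ j → toℕ i ≡ toℕ j → x ≡ inj₂ (e , j) → Target e i x

    target : ∀ e i → Target e i (tgt J′ (e , i))
    target e i with view i
    ... | ‵fromℕ     = last refl refl
    ... | ‵inject₁ j = inner j (toℕ-inject₁ j) refl

    -- A subdivision vertex at either end determines the edge, given the direction. With none, the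
    -- path is a single edge, both first and last, and `parallel-injective` decides.
    ε-injective-parallel : ∀ k k′ → src J′ k ≡ src J′ k′ → tgt J′ k ≡ tgt J′ k′ → ε k ≡ ε k′ → k ≡ k′
    ε-injective-parallel (e , suc i) (e′ , suc i′) ps _ _ with inj₂-injective ps
    ... | refl = refl
    ε-injective-parallel (e , zero) (e′ , zero) ps pt pe with target e zero | target e′ zero
    ... | last z q | last z′ q′
      with parallel-injective e e′ (inj₁-injective ps) (inj₁-injective (trans (sym q) (trans pt q′)))
             (trans (cong (edgeAt G (path e)) (sym z)) (trans pe (cong (edgeAt G (path e′)) z′)))
    ...   | refl = refl
    ε-injective-parallel (e , zero) (e′ , zero) ps pt pe | inner j _ q | inner j′ _ q′
      with inj₂-injective (trans (sym q) (trans pt q′))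
    ...   | refl = refl
    ε-injective-parallel (e , zero) (e′ , zero) ps pt pe | last _ q | inner _ _ q′ with trans (sym q) (trans pt q′)
    ...   | ()
    ε-injective-parallel (e , zero) (e′ , zero) ps pt pe | inner _ _ q | last _ q′ with trans (sym q) (trans pt q′)
    ...   | ()

    -- Swapped ends without subdivision vertices contradict `noAntiparallel`. One shared subdivision
    -- vertex would close a path of two edges, hence a loop of `J`; two would make an index exceed
    -- itself by two.
    noAntiparallel′ : ∀ k k′ → src J′ k ≡ tgt J′ k′ → tgt J′ k ≢ src J′ k′
    noAntiparallel′ (e , i) (e′ , i′) p p′ with target e i | target e′ i′
    noAntiparallel′ (e , zero) (e′ , zero) p p′ | last _ q | last _ q′ =
      noAntiparallel e e′ (inj₁-injective (trans p q′)) (inj₁-injective (trans (sym q) p′))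
    noAntiparallel′ (e , zero) (e′ , suc i′) p p′ | last _ q | last _ q′ with trans (sym q) p′
    ... | ()
    noAntiparallel′ (e , zero) (e′ , zero) p p′ | inner _ _ q | last _ q′ with trans (sym q) p′
    ... | ()
    noAntiparallel′ (e , zero) (e′ , suc i′) p p′ | inner _ _ q | last _ q′ with inj₂-injective (trans (sym q) p′)
    ... | refl = loopless J e (inj₁-injective (trans p q′))
    noAntiparallel′ (e , zero) (e′ , i′) p p′ | _ | inner _ _ q′ with trans p q′
    ... | ()
    noAntiparallel′ (e , suc i) (e′ , i′) p p′ | _ | last _ q′ with trans p q′
    ... | ()
    noAntiparallel′ (e , suc i) (e′ , i′) p p′ | last _ q | inner _ n′ q′ with inj₂-injective (trans p q′)
    noAntiparallel′ (e , suc i) (e′ , zero) p p′ | last _ q | inner _ n′ q′ | refl =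
      loopless J e (sym (inj₁-injective (trans (sym q) p′)))
    noAntiparallel′ (e , suc i) (e′ , suc i′) p p′ | last _ q | inner _ n′ q′ | refl with trans (sym q) p′
    ... | ()
    noAntiparallel′ (e , suc i) (e′ , zero) p p′ | inner _ n q | inner _ n′ q′ with trans (sym q) p′
    ... | ()
    noAntiparallel′ (e , suc i) (e′ , suc i′) p p′ | inner _ n q | inner _ n′ q′
      with inj₂-injective (trans p q′) | inj₂-injective (trans (sym q) p′)
    ... | refl | refl = 2+n≢n (trans (cong suc n) n′)
      where
      2+n≢n : ∀ {n} → suc (suc n) ≢ n
      2+n≢n ()

    ε-injective : ∀ {k k′} → ε k ≡ ε k′ → k ≡ k′
    ε-injective {k} {k′} eq with Joins-ends G eq (ε-joins k) (ε-joins k′)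
    ... | inj₁ (p , q) = ε-injective-parallel k k′ (φ-injective p) (φ-injective q) eq
    ... | inj₂ (p , q) = ⊥-elim (noAntiparallel′ k k′ (φ-injective p) (φ-injective q))

    module φ-Image = Image _≟V_ φ φ-injective V′s V′s-complete
    module ε-Image = Image _≟E_ ε ε-injective E′s E′s-complete

  realization : Subgraph G
  realization .VS = φ-Image.isImage
  realization .ES = ε-Image.isImage
  realization .closed e p with ε-Image.preimage (e , p)
  ... | k , refl with ε-joins k
  ...   | inj₁ (ps , pt) = subst (T ∘ φ-Image.isImage) (sym ps) (φ-Image.isImage⁺ (src J′ k)) ,
                           subst (T ∘ φ-Image.isImage) (sym pt) (φ-Image.isImage⁺ (tgt J′ k))
  ...   | inj₂ (ps , pt) = subst (T ∘ φ-Image.isImage) (sym ps) (φ-Image.isImage⁺ (tgt J′ k)) ,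
                           subst (T ∘ φ-Image.isImage) (sym pt) (φ-Image.isImage⁺ (src J′ k))

  realization-isBisubdivision : graph realization IsBisubdivisionOf J
  realization-isBisubdivision = s , (λ e → Odd-interior-even G (path e)) , record
    { onV = φ-Image.image↔ ; onE = ε-Image.image↔ ; joins = joins }
    where
    joins : ∀ e → Joins J′ (Inverse.to ε-Image.image↔ e)
              (Inverse.to φ-Image.image↔ (src (graph realization) e))
              (Inverse.to φ-Image.image↔ (tgt (graph realization) e))
    joins e = Sum.map (λ (p , q) → φ-injective p , φ-injective q) (λ (p , q) → φ-injective p , φ-injective q)
      (Joins-ends G (sym (proj₂ (ε-Image.preimage e))) (ε-joins (proj₁ (ε-Image.preimage e)))
        (inj₁ (proj₂ (φ-Image.preimage (src (graph realization) e)) ,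
               proj₂ (φ-Image.preimage (tgt (graph realization) e)))))

  lastEdge∈realization : ∀ e → T (ES realization (lastEdge G (path e)))
  lastEdge∈realization e = ε-Image.isImage⁺ (e , fromℕ _)

  realization-conformal : Conformal realization
  realization-conformal = M , perfect
    where
    D : Subgraph G
    D = deleteVertices G (VS realization)
    M : E (graph D) → Bool
    M (e , _) = ⌊ e ∈? matchedEdges G matched ⌋
    inRest : ∀ v → T (VS D v) → v ∈ R
    inRest v p with ∈-++⁻ (map φ V′s) (subst (λ xs → v ∈ xs ++ R) (sym φ-V′s) (complete v))
    ... | inj₁ q = ⊥-elim (toWitnessFalse p q)
    ... | inj₂ q = q
    outside : ∀ {v} → v ∈ R → T (VS D v)
    outside q = fromWitnessFalse λ p → proj₂ (proj₂ unique′) (p , q)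
    lower : ∀ {e v} → Incident (graph D) e v → Incident G (proj₁ e) (proj₁ v)
    lower (inj₁ p) = inj₁ (cong proj₁ p)
    lower (inj₂ p) = inj₂ (cong proj₁ p)
    lift : ∀ {e v} → Incident G (proj₁ e) (proj₁ v) → Incident (graph D) e v
    lift (inj₁ p) = inj₁ (Σ-T-≡ p)
    lift (inj₂ p) = inj₂ (Σ-T-≡ p)
    perfect : PerfectMatching (graph D) M
    perfect (v , p) with matchedEdges-cover G matched (inRest v p)
    ... | e , e∈ , inc = (e , Equivalence.from T-∧
              (outside (matchedEdges-ends G matched e∈ (inj₁ refl)) ,
               outside (matchedEdges-ends G matched e∈ (inj₂ refl)))) ,
            (fromWitness e∈ , lift inc) ,
            λ (q , inc′) → Σ-T-≡ (matchedEdges-unique G matched (proj₁ (proj₂ unique′)) e∈ (toWitness q) inc (lower inc′))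

  realize : Σ[ H ∈ Subgraph G ] ((∀ e → T (ES H (lastEdge G (path e)))) × Conformal H × graph H IsBisubdivisionOf J)
  realize = realization , lastEdge∈realization , realization-conformal , realization-isBisubdivision

-- Perfect matchings as involutions

Finite⇒list : {A : Set} {n : ℕ} → A ↔ Fin n → ∃[ xs ] (Unique {A = A} xs × ∀ x → x ∈ xs)
Finite⇒list {n = n} f = map (Inverse.from f) (allFin n) ,
  UniqueProps.map⁺ (λ {i} {j} eq → trans (sym (Inverse.inverseˡ f refl)) (trans (cong (Inverse.to f) eq) (Inverse.inverseˡ f refl)))
    (UniqueProps.allFin⁺ n) ,
  λ x → subst (_∈ _) (Inverse.inverseʳ f refl) (∈-map⁺ (Inverse.from f) (∈-allFin (Inverse.to f x)))

module Mates (G : Graph) (M : E G → Bool) (perfect : PerfectMatching G M) where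

  otherEnd : ∀ {e v} → Incident G e v → ∃[ w ] Joins G e v w
  otherEnd {e} (inj₁ s) = tgt G e , inj₁ (s , refl)
  otherEnd {e} (inj₂ t) = src G e , inj₂ (refl , t)

  Joins⇒Incident : ∀ {e v w} → Joins G e v w → Incident G e v
  Joins⇒Incident (inj₁ (s , _)) = inj₁ s
  Joins⇒Incident (inj₂ (_ , t)) = inj₂ t

  Joins-unique : ∀ {e u v w} → Joins G e u v → Joins G e u w → v ≡ w
  Joins-unique j k with Joins-ends G refl j k
  ... | inj₁ (_ , eq)      = eq
  ... | inj₂ (refl , refl) = refl

  mate : V G → V G
  mate v = proj₁ (otherEnd (proj₂ (proj₁ (proj₂ (perfect v)))))

  mate-joins : ∀ v → Joins G (proj₁ (perfect v)) v (mate v)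
  mate-joins v = proj₂ (otherEnd (proj₂ (proj₁ (proj₂ (perfect v)))))

  mate-adjacent : ∀ v → Adjacent G v (mate v)
  mate-adjacent v = proj₁ (perfect v) , mate-joins v

  mate-unique : ∀ {e v w} → T (M e) → Joins G e v w → mate v ≡ w
  mate-unique {v = v} e∈M j with proj₂ (proj₂ (perfect v)) (e∈M , Joins⇒Incident j)
  ... | refl = Joins-unique (mate-joins v) j

  mate-involutive : ∀ v → mate (mate v) ≡ v
  mate-involutive v = mate-unique (proj₁ (proj₁ (proj₂ (perfect v)))) (Joins-sym G (mate-joins v))

-- Joining the claw to a spider

ThetaOrK₄Through : (G : Graph) → E G → E G → E G → Set
ThetaOrK₄Through G e₁ e₂ e₃ =
  Σ[ H ∈ Subgraph G ] ((T (ES H e₁) × T (ES H e₂) × T (ES H e₃)) × Conformal H ×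
    (graph H IsBisubdivisionOf Θ ⊎ graph H IsBisubdivisionOf Complete 4))

module _ (G : Graph) (_≟V_ : DecidableEquality (V G)) (_≟E_ : DecidableEquality (E G)) where

  open Walks G
  open CMSolver (++-commutativeMonoid {A = V G}) using (solve; _⊕_; _⊜_; id)

  lastEdge-∷ʳ : ∀ {u w v L e} (p : Even u w L) (j : Joins G e w v) → lastEdge G (p ∷ʳ (e , j)) ≡ e
  lastEdge-∷ʳ nil          j = refl
  lastEdge-∷ʳ (step _ _ p) j = lastEdge-∷ʳ p j

  -- The paths of the embedded Θ or K₄ that meet c are directed towards c, so that
  -- the claw edges are their last edges.
  attachClaw : ∀ {c a₁ a₂ a₃ e₁ e₂ e₃ X} → e₁ ≢ e₂ → e₁ ≢ e₃ → e₂ ≢ e₃ →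
               Joins G e₁ c a₁ → Joins G e₂ c a₂ → Joins G e₃ c a₃ →
               Spider a₁ a₂ a₃ X → Unique (c ∷ X) → (∀ v → v ∈ c ∷ X) → ThetaOrK₄Through G e₁ e₂ e₃
  attachClaw {c} {e₁ = e₁} {e₂} {e₃} {X} e₁≢e₂ e₁≢e₃ e₂≢e₃ j₁ j₂ j₃ (tree {w} {L₁} {L₂} {L₃} {R} l₁ l₂ l₃ m perm) unique complete =
    conclude (Realize.realize G _≟V_ _≟E_ Θ (allFin 2) ∈-allFin (allFin 3) ∈-allFin (λ _ _ ())
      branch interior path
      -- All edges of `Θ` are parallel, so the paths are told apart by the distinct claw edges that
      -- end them.
      (λ i j _ _ eq → edge-injective i j (trans (sym (lastEdge-path i)) (trans eq (lastEdge-path j))))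
      m (Unique-resp-↭ rearranged unique) (∈-resp-↭ rearranged ∘ complete))
    where
    edge : Fin 3 → E G
    edge 0F = e₁
    edge 1F = e₂
    edge 2F = e₃

    edge-injective : ∀ i j → edge i ≡ edge j → i ≡ j
    edge-injective 0F 0F _  = refl
    edge-injective 0F 1F eq = ⊥-elim (e₁≢e₂ eq)
    edge-injective 0F 2F eq = ⊥-elim (e₁≢e₃ eq)
    edge-injective 1F 0F eq = ⊥-elim (e₁≢e₂ (sym eq))
    edge-injective 1F 1F _  = refl
    edge-injective 1F 2F eq = ⊥-elim (e₂≢e₃ eq)
    edge-injective 2F 0F eq = ⊥-elim (e₁≢e₃ (sym eq))
    edge-injective 2F 1F eq = ⊥-elim (e₂≢e₃ (sym eq))
    edge-injective 2F 2F _  = refl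

    branch : Fin 2 → V G
    branch 0F = w
    branch 1F = c

    interior : Fin 3 → List (V G)
    interior 0F = L₁
    interior 1F = L₂
    interior 2F = L₃

    path : ∀ i → Odd w c (interior i)
    path 0F = l₁ ∷ʳ (e₁ , Joins-sym G j₁)
    path 1F = l₂ ∷ʳ (e₂ , Joins-sym G j₂)
    path 2F = l₃ ∷ʳ (e₃ , Joins-sym G j₃)

    lastEdge-path : ∀ i → lastEdge G (path i) ≡ edge i
    lastEdge-path 0F = lastEdge-∷ʳ l₁ (Joins-sym G j₁)
    lastEdge-path 1F = lastEdge-∷ʳ l₂ (Joins-sym G j₂)
    lastEdge-path 2F = lastEdge-∷ʳ l₃ (Joins-sym G j₃)

    rearranged : c ∷ X ↭ (w ∷ c ∷ L₁ ++ L₂ ++ L₃ ++ []) ++ R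
    rearranged = ↭-trans (↭-prep c perm)
      (solve 6 (λ c w L₁ L₂ L₃ R → (c ⊕ (w ⊕ (L₁ ⊕ (L₂ ⊕ (L₃ ⊕ R)))))
                                 ⊜ ((w ⊕ (c ⊕ (L₁ ⊕ (L₂ ⊕ (L₃ ⊕ id))))) ⊕ R))
        ↭-refl [ c ] [ w ] L₁ L₂ L₃ R)

    conclude : Σ[ H ∈ Subgraph G ] ((∀ i → T (ES H (lastEdge G (path i)))) × Conformal H × graph H IsBisubdivisionOf Θ) →
               ThetaOrK₄Through G e₁ e₂ e₃
    conclude (H , last∈H , conformal , bisubdivision) =
      H , (onH 0F , onH 1F , onH 2F) , conformal , inj₁ bisubdivision
      where
      onH : ∀ i → T (ES H (edge i))
      onH i = subst (T ∘ ES H) (lastEdge-path i) (last∈H i)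

  attachClaw {c} {e₁ = e₁} {e₂} {e₃} {X} _ _ _ j₁ j₂ j₃
    (triangle {w₁} {w₂} {w₃} {L₁} {L₂} {L₃} {I₁₂} {I₁₃} {I₂₃} {R} l₁ l₂ l₃ s₁₂ s₁₃ s₂₃ m perm) unique complete =
    conclude (Realize.realize G _≟V_ _≟E_ (Complete 4) (allFin 4) ∈-allFin edges edges-complete
      (λ { (_ , p) (_ , p′) refl refl → <-asym p p′ })
      branch interior path (λ e e′ p q _ → simple e e′ p q)
      m (Unique-resp-↭ rearranged unique) (∈-resp-↭ rearranged ∘ complete))
    where
    pattern e01 = (0F , 1F) , s≤s z≤n
    pattern e02 = (0F , 2F) , s≤s z≤n
    pattern e03 = (0F , 3F) , s≤s z≤n
    pattern e12 = (1F , 2F) , s≤s (s≤s z≤n)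
    pattern e13 = (1F , 3F) , s≤s (s≤s z≤n)
    pattern e23 = (2F , 3F) , s≤s (s≤s (s≤s z≤n))

    edges : List (E (Complete 4))
    edges = e01 ∷ e02 ∷ e03 ∷ e12 ∷ e13 ∷ e23 ∷ []

    edges-complete : ∀ e → e ∈ edges
    edges-complete e01 = here refl
    edges-complete e02 = there (here refl)
    edges-complete e03 = there (there (here refl))
    edges-complete e12 = there (there (there (here refl)))
    edges-complete e13 = there (there (there (there (here refl))))
    edges-complete e23 = there (there (there (there (there (here refl)))))

    branch : Fin 4 → V G
    branch 0F = w₁
    branch 1F = w₂
    branch 2F = w₃
    -- `Complete` directs edges to the larger index, so `c` takes the largest.
    branch 3F = c

    interior : E (Complete 4) → List (V G)
    interior e01 = I₁₂
    interior e02 = I₁₃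
    interior e03 = L₁
    interior e12 = I₂₃
    interior e13 = L₂
    interior e23 = L₃

    path : ∀ e → Odd (branch (src (Complete 4) e)) (branch (tgt (Complete 4) e)) (interior e)
    path e01 = s₁₂
    path e02 = s₁₃
    path e03 = l₁ ∷ʳ (e₁ , Joins-sym G j₁)
    path e12 = s₂₃
    path e13 = l₂ ∷ʳ (e₂ , Joins-sym G j₂)
    path e23 = l₃ ∷ʳ (e₃ , Joins-sym G j₃)

    simple : ∀ e e′ → src (Complete 4) e ≡ src (Complete 4) e′ → tgt (Complete 4) e ≡ tgt (Complete 4) e′ → e ≡ e′
    simple (_ , p) (_ , p′) refl refl = cong (_ ,_) (<-irrelevant p p′)

    rearranged : c ∷ X ↭ (w₁ ∷ w₂ ∷ w₃ ∷ c ∷ I₁₂ ++ I₁₃ ++ L₁ ++ I₂₃ ++ L₂ ++ L₃ ++ []) ++ R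
    rearranged = ↭-trans (↭-prep c perm)
      (solve 11 (λ c w₁ w₂ w₃ L₁ L₂ L₃ I₁₂ I₁₃ I₂₃ R →
          (c ⊕ (w₁ ⊕ (w₂ ⊕ (w₃ ⊕ (L₁ ⊕ (L₂ ⊕ (L₃ ⊕ (I₁₂ ⊕ (I₁₃ ⊕ (I₂₃ ⊕ R))))))))))
        ⊜ ((w₁ ⊕ (w₂ ⊕ (w₃ ⊕ (c ⊕ (I₁₂ ⊕ (I₁₃ ⊕ (L₁ ⊕ (I₂₃ ⊕ (L₂ ⊕ (L₃ ⊕ id)))))))))) ⊕ R))
        ↭-refl [ c ] [ w₁ ] [ w₂ ] [ w₃ ] L₁ L₂ L₃ I₁₂ I₁₃ I₂₃ R)

    conclude : Σ[ H ∈ Subgraph G ] ((∀ e → T (ES H (lastEdge G (path e)))) × Conformal H × graph H IsBisubdivisionOf Complete 4) →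
               ThetaOrK₄Through G e₁ e₂ e₃
    conclude (H , last∈H , conformal , bisubdivision) =
      H , (subst (T ∘ ES H) (lastEdge-∷ʳ l₁ (Joins-sym G j₁)) (last∈H e03) ,
           subst (T ∘ ES H) (lastEdge-∷ʳ l₂ (Joins-sym G j₂)) (last∈H e13) ,
           subst (T ∘ ES H) (lastEdge-∷ʳ l₃ (Joins-sym G j₃)) (last∈H e23)) , conformal , inj₂ bisubdivision

-- The claw and its three matchings

edges⊑⇒⊑ : {G : Graph} (K H : Subgraph G) → (∀ v → T (VS K v) → ∃[ e ] (T (ES K e) × Incident G e v)) →
           (∀ e → T (ES K e) → T (ES H e)) → K ⊑ H
edges⊑⇒⊑ {G} K H noIsolated edges⊑ = (λ v → endpoint ∘ noIsolated v) , edges⊑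
  where
  endpoint : ∀ {v} → ∃[ e ] (T (ES K e) × Incident G e v) → T (VS H v)
  endpoint (e , e∈K , inj₁ refl) = proj₁ (closed H e (edges⊑ e e∈K))
  endpoint (e , e∈K , inj₂ refl) = proj₂ (closed H e (edges⊑ e e∈K))

theorem2p7 : (G : Graph) → Finite G → MatchingCovered G →
    (K : Subgraph G) → ThreeClaw K →
    ∃[ H ] (K ⊑ H × Conformal H ×
    (graph H IsBisubdivisionOf Θ ⊎ graph H IsBisubdivisionOf Complete 4))
theorem2p7 G ((_ , finV) , (_ , finE)) mc K
  (c , e₁ , e₂ , e₃ , (e₁≢e₂ , e₁≢e₃ , e₂≢e₃) , (i₁ , i₂ , i₃) , edgesK , verticesK) =
  let H , (e₁∈H , e₃∈H , e₂∈H) , conformal , bisubdivision = found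
  in H , edges⊑⇒⊑ K H (λ v → Equivalence.to (verticesK v)) (λ e e∈K →
           [ (λ { refl → e₁∈H }) , [ (λ { refl → e₂∈H }) , (λ { refl → e₃∈H }) ]′ ]′ (Equivalence.to (edgesK e) e∈K)) ,
     conformal , bisubdivision
  where
  _≟V_ : DecidableEquality (V G)
  _≟V_ = inj⇒≟ (↔⇒↣ finV)

  _≟E_ : DecidableEquality (E G)
  _≟E_ = inj⇒≟ (↔⇒↣ finE)

  module Covering (e : E G) where
    private cov = MatchingCovered.covered mc e
    open Mates G (proj₁ cov) (proj₁ (proj₂ cov)) public
    mate-end : Incident G e c → Joins G e c (mate c)
    mate-end i = subst (Joins G e c) (sym (mate-unique (proj₂ (proj₂ cov)) (proj₂ (otherEnd i)))) (proj₂ (otherEnd i))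

  module M₁ = Covering e₁
  module M₂ = Covering e₂
  module M₃ = Covering e₃

  -- The order follows the feet of the spider, where the end of the walk from M₃ precedes that from
  -- M₂.
  found : ThetaOrK₄Through G e₁ e₃ e₂
  found =
    let _ , uVs , complete = Finite⇒list finV
        _ , spider , unique , complete′ =
          Walks.Alternating.spiderAt G _≟V_ M₁.mate M₁.mate-involutive M₁.mate-adjacent uVs complete
            M₂.mate M₂.mate-involutive M₂.mate-adjacent M₃.mate M₃.mate-involutive M₃.mate-adjacent c
    in attachClaw G _≟V_ _≟E_ e₁≢e₃ e₁≢e₂ (e₂≢e₃ ∘ sym) (M₁.mate-end i₁) (M₃.mate-end i₃) (M₂.mate-end i₂)
         spider unique complete′
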